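{- There is no existential-positive first-order sentence equivalent on $\mathcal{S}$ to the sentence $$\phi:=\exists x\exists y\Big(P(x)\wedge P(y)\wedge\lambda(x,y)\wedge\forall z_1\forall z_2\big((\beta(x,y,z_1)\wedge\beta(x,y,z_2)\wedge\nu(z_1,z_2))\rightarrow S(z_1,z_2)\big)\Big),$$ where $x\le y$ abbreviates $O(x,y)\vee x=y$, $\beta(x,y,z):=x\le z\wedge z\le y$, $\lambda(x,y):=O(x,y)\wedge\forall z_1\forall z_2\big((\beta(x,y,z_1)\wedge\beta(x,y,z_2))\rightarrow(z_1\le z_2\vee z_2\le z_1)\big)$, and $\nu(z_1,z_2):=O(z_1,z_2)\wedge\forall w\,\neg(O(z_1,w)\wedge O(w,z_2))$. (Consequently, $\mathcal{S}$ is a class of finite structures closed under substructures and disjoint unions that does not have the homomorphism preservation property.)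
   Context: $\tau$ is the signature with binary relation symbols $O,S$ and unary $P$. For $n\in\mathbb{N}$, $L_n$ is the $\tau$-structure with universe $\{1,\dots,n\}$, $O^{L_n}=\{(i,j):i<j\}$, $S^{L_n}=\{(i,i+1):1\le i<n\}$, $P^{L_n}=\{1,n\}$. Substructures are not necessarily induced ($A\subseteq B$, $R^{\mathbf{A}}\subseteq R^{\mathbf{B}}$). Disjoint union takes the disjoint union of universes and of relations. $\mathcal{S}$ is the closure of the class of structures isomorphic to some $L_n$ under taking substructures and disjoint unions. Existential-positive formulas are built from atomic formulas using $\wedge,\vee,\exists$. Equivalence on $\mathcal{S}$ means having the same truth value in every structure of $\mathcal{S}$. A class has the homomorphism preservation property if every first-order sentence preserved under homomorphisms on the class (i.e., truth transfers along homomorphisms between members of the class) is equivalent on the class to an existential-positive sentence. -}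

module Defs where

open import Data.Nat using (ℕ; zero; suc; _+_; _∸_; _<ᵇ_; _≡ᵇ_)
open import Data.Bool using (Bool; true; false; _∨_)
open import Data.Fin using (Fin; toℕ; splitAt)
open import Data.Sum using (_⊎_; inj₁; inj₂)
open import Data.Product using (Σ; _×_)
open import Relation.Binary.PropositionalEquality using (_≡_)
open import Relation.Nullary using (¬_)
open import Function.Definitions using (Injective)

-- Finite τ-structures, τ = {O, S binary; P unary}.
-- Universe is Fin size; relations are Boolean-valued (hence decidable),
-- so constructive and classical truth of first-order sentences coincide.
record Str : Set where
  field
    size : ℕ
    O    : Fin size → Fin size → Bool
    S    : Fin size → Fin size → Bool
    P    : Fin size → Bool
open Str public

-- L n : universe {1..n} represented by Fin n (element i ↦ toℕ i + 1).
L : ℕ → Str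
L n = record
  { size = n
  ; O = λ i j → toℕ i <ᵇ toℕ j
  ; S = λ i j → suc (toℕ i) ≡ᵇ toℕ j
  ; P = λ i → (toℕ i ≡ᵇ 0) ∨ (suc (toℕ i) ≡ᵇ n)
  }

lift2 : {a b : ℕ} → (Fin a → Fin a → Bool) → (Fin b → Fin b → Bool)
      → Fin (a + b) → Fin (a + b) → Bool
lift2 {a} RA RB x y with splitAt a x | splitAt a y
... | inj₁ x' | inj₁ y' = RA x' y'
... | inj₂ x' | inj₂ y' = RB x' y'
... | _       | _       = false

lift1 : {a b : ℕ} → (Fin a → Bool) → (Fin b → Bool) → Fin (a + b) → Bool
lift1 {a} PA PB x with splitAt a x
... | inj₁ x' = PA x'
... | inj₂ x' = PB x'

_⊕_ : Str → Str → Str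
A ⊕ B = record
  { size = size A + size B
  ; O = lift2 (O A) (O B)
  ; S = lift2 (S A) (S B)
  ; P = lift1 (P A) (P B)
  }

-- A is (isomorphic to) a (not necessarily induced) substructure of B:
-- an injective map preserving O, S, P.
record SubOf (A B : Str) : Set where
  field
    f      : Fin (size A) → Fin (size B)
    inj    : Injective _≡_ _≡_ f
    presO  : ∀ x y → O A x y ≡ true → O B (f x) (f y) ≡ true
    presS  : ∀ x y → S A x y ≡ true → S B (f x) (f y) ≡ true
    presP  : ∀ x → P A x ≡ true → P B (f x) ≡ true

-- The class 𝒮: closure of {structures isomorphic to some L n} under
-- substructures and disjoint unions (isomorphic copies are covered by SubOf).
data In𝒮 : Str → Set where
  base  : ∀ n → In𝒮 (L n)
  sub   : ∀ {A B} → In𝒮 B → SubOf A B → In𝒮 A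
  union : ∀ {A B} → In𝒮 A → In𝒮 B → In𝒮 (A ⊕ B)

data EP (n : ℕ) : Set where
  atO atS atEq : Fin n → Fin n → EP n
  atP          : Fin n → EP n
  _∧ᵉ_ _∨ᵉ_    : EP n → EP n → EP n
  ∃ᵉ           : EP (suc n) → EP n

extend : {n m : ℕ} → Fin m → (Fin n → Fin m) → Fin (suc n) → Fin m
extend a ρ Fin.zero    = a
extend a ρ (Fin.suc i) = ρ i

Sat : (A : Str) {n : ℕ} → EP n → (Fin n → Fin (size A)) → Set
Sat A (atO i j)  ρ = O A (ρ i) (ρ j) ≡ true
Sat A (atS i j)  ρ = S A (ρ i) (ρ j) ≡ true
Sat A (atEq i j) ρ = ρ i ≡ ρ j
Sat A (atP i)    ρ = P A (ρ i) ≡ true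
Sat A (φ ∧ᵉ ψ)   ρ = Sat A φ ρ × Sat A ψ ρ
Sat A (φ ∨ᵉ ψ)   ρ = Sat A φ ρ ⊎ Sat A ψ ρ
Sat A (∃ᵉ φ)     ρ = Σ (Fin (size A)) λ a → Sat A φ (extend a ρ)

EPSentence : Set
EPSentence = EP 0

emptyEnv : {m : ℕ} → Fin 0 → Fin m
emptyEnv ()

_⊨_ : Str → EPSentence → Set
A ⊨ ψ = Sat A ψ emptyEnv

module _ (A : Str) where
  _≤ᴬ_ : Fin (size A) → Fin (size A) → Set
  x ≤ᴬ y = O A x y ≡ true ⊎ x ≡ y

  β : Fin (size A) → Fin (size A) → Fin (size A) → Set
  β x y z = x ≤ᴬ z × z ≤ᴬ y

  λᶠ : Fin (size A) → Fin (size A) → Set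
  λᶠ x y = O A x y ≡ true
         × (∀ z₁ z₂ → (β x y z₁ × β x y z₂) → (z₁ ≤ᴬ z₂ ⊎ z₂ ≤ᴬ z₁))

  ν : Fin (size A) → Fin (size A) → Set
  ν z₁ z₂ = O A z₁ z₂ ≡ true
          × (∀ w → ¬ (O A z₁ w ≡ true × O A w z₂ ≡ true))

  φ-holds : Set
  φ-holds = Σ (Fin (size A)) λ x → Σ (Fin (size A)) λ y →
      P A x ≡ true × P A y ≡ true × λᶠ x y
    × (∀ z₁ z₂ → (β x y z₁ × β x y z₂ × ν z₁ z₂) → S A z₁ z₂ ≡ true)

-- An existential-positive sentence ψ mentions at most k = (number of S-atoms of ψ)
-- S-edges in any satisfying assignment.  In L (k + 2) the sentence φ holds, so ψ
-- holds, and by pigeonhole one of the k + 1 successor edges (m, m + 1) is unused.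
-- Deleting it yields a substructure of L (k + 2), hence a member of 𝒮, which still
-- satisfies ψ (positive formulas only need the edges they use) but not φ: its
-- P-endpoints are still 1 and k + 2 and the O-consecutive pair m, m + 1 between
-- them is no longer an S-edge.
module Submission where

open import Defs
open import Data.Product using (Σ)
open import Relation.Nullary using (¬_)
open import Function.Bundles using (_⇔_)
open import Data.Bool using (true; false; not; _∧_)
open import Data.Bool.Properties using (T-≡; T-∨; ∧-zeroʳ)
open import Data.Fin using (Fin; zero; toℕ; fromℕ; fromℕ<)
open import Data.Fin.Properties using (toℕ-injective; toℕ<n; toℕ-fromℕ; toℕ-fromℕ<)
open import Data.List using (List; []; _∷_; _++_; length)
open import Data.List.Properties using (length-++; length-++-sucʳ)
open import Data.List.Membership.Propositional using (_∉_)
open import Data.List.Membership.Propositional.Properties using (∈-++⁺ˡ; ∈-++⁺ʳ; ∈-++⁻; ∈-∃++)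
open import Data.List.Relation.Unary.Any using (here; there)
open import Data.Nat using (ℕ; suc; _+_; _≤_; _<_; z≤n; s≤s; _≡ᵇ_)
open import Data.Nat.Properties
open import Data.List.Membership.DecPropositional _≟_ using (_∈?_)
open import Data.Product using (∃; _×_; _,_)
open import Data.Sum using (_⊎_; inj₁; inj₂; [_,_])
import Data.Sum as Sum
open import Function using (_∘_)
open import Function.Bundles using (Equivalence)
open import Relation.Binary.PropositionalEquality using (_≡_; _≢_; refl; sym; trans; cong; subst; module ≡-Reasoning)
open import Relation.Nullary using (yes; no; contradiction)

open Equivalence using (to; from)

countS : ∀ {n} → EP n → ℕ
countS (atO _ _)  = 0
countS (atS _ _)  = 1
countS (atEq _ _) = 0
countS (atP _)    = 0
countS (φ ∧ᵉ ψ)   = countS φ + countS ψ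
countS (φ ∨ᵉ ψ)   = countS φ + countS ψ
countS (∃ᵉ φ)     = countS φ

-- The vertex is named by its index toℕ so that the pigeonhole argument can work
-- with lists of naturals.
dropSFrom : Str → ℕ → Str
dropSFrom A m = record
  { size = size A
  ; O    = O A
  ; S    = λ i j → S A i j ∧ not (toℕ i ≡ᵇ m)
  ; P    = P A
  }

dropSFrom-SubOf : ∀ A m → SubOf (dropSFrom A m) A
dropSFrom-SubOf A m = record
  { f     = λ x → x
  ; inj   = λ e → e
  ; presO = λ _ _ o → o
  ; presS = λ x y → ∧-true-left (S A x y)
  ; presP = λ _ p → p
  }
  where
  ∧-true-left : ∀ a {b} → a ∧ b ≡ true → a ≡ true
  ∧-true-left true _ = refl

dropSFrom-¬S : ∀ A m {a b} → toℕ a ≡ m → ¬ (S (dropSFrom A m) a b ≡ true)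
dropSFrom-¬S A _ {a} {b} refl s = contradiction (begin
  true                               ≡⟨ s ⟨
  S A a b ∧ not (toℕ a ≡ᵇ toℕ a)     ≡⟨ cong (λ c → S A a b ∧ not c) (to T-≡ (≡⇒≡ᵇ (toℕ a) (toℕ a) refl)) ⟩
  S A a b ∧ false                    ≡⟨ ∧-zeroʳ (S A a b) ⟩
  false                              ∎) λ ()
  where open ≡-Reasoning

dropSFrom-S : ∀ A m {a b} → toℕ a ≢ m → S A a b ≡ true → S (dropSFrom A m) a b ≡ true
dropSFrom-S A m {a} a≢m s rewrite s with toℕ a ≡ᵇ m in eq
... | false = refl
... | true  = contradiction (≡ᵇ⇒≡ (toℕ a) m (from T-≡ eq)) a≢m

Sat-dropSFrom : ∀ A {n} (ψ : EP n) (ρ : Fin n → Fin (size A)) → Sat A ψ ρ →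
  ∃ λ (l : List ℕ) → length l ≤ countS ψ × (∀ m → m ∉ l → Sat (dropSFrom A m) ψ ρ)
Sat-dropSFrom A (atO _ _)  ρ s = [] , z≤n , λ _ _ → s
Sat-dropSFrom A (atS i j)  ρ s =
  toℕ (ρ i) ∷ [] , ≤-refl , λ m m∉ → dropSFrom-S A m (λ e → m∉ (here (sym e))) s
Sat-dropSFrom A (atEq _ _) ρ s = [] , z≤n , λ _ _ → s
Sat-dropSFrom A (atP _)    ρ s = [] , z≤n , λ _ _ → s
Sat-dropSFrom A (φ ∧ᵉ ψ) ρ (sφ , sψ)
  with lφ , lφ≤ , kφ ← Sat-dropSFrom A φ ρ sφ
     | lψ , lψ≤ , kψ ← Sat-dropSFrom A ψ ρ sψ =
  lφ ++ lψ ,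
  subst (_≤ countS φ + countS ψ) (sym (length-++ lφ)) (+-mono-≤ lφ≤ lψ≤) ,
  λ m m∉ → kφ m (m∉ ∘ ∈-++⁺ˡ) , kψ m (m∉ ∘ ∈-++⁺ʳ lφ)
Sat-dropSFrom A (φ ∨ᵉ ψ) ρ (inj₁ sφ) with l , l≤ , k ← Sat-dropSFrom A φ ρ sφ =
  l , ≤-trans l≤ (m≤m+n _ _) , λ m m∉ → inj₁ (k m m∉)
Sat-dropSFrom A (φ ∨ᵉ ψ) ρ (inj₂ sψ) with l , l≤ , k ← Sat-dropSFrom A ψ ρ sψ =
  l , ≤-trans l≤ (m≤n+m _ _) , λ m m∉ → inj₂ (k m m∉)
Sat-dropSFrom A (∃ᵉ φ) ρ (a , s) with l , l≤ , k ← Sat-dropSFrom A φ (extend a ρ) s =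
  l , l≤ , λ m m∉ → a , k m m∉

∃∉-below : ∀ N (l : List ℕ) → length l < N → ∃ λ m → m < N × m ∉ l
∃∉-below (suc N) l l<1+N with N ∈? l
... | no N∉l = N , ≤-refl , N∉l
... | yes N∈l with xs , ys , refl ← ∈-∃++ N∈l
                 with m , m<N , m∉ ← ∃∉-below N (xs ++ ys)
                                      (≤-pred (subst (_< suc N) (length-++-sucʳ xs N ys) l<1+N)) =
  m , m≤n⇒m≤1+n m<N , λ m∈ → [ m∉ ∘ ∈-++⁺ˡ , notN ] (∈-++⁻ xs m∈)
  where
  notN : m ∉ N ∷ ys
  notN (here refl) = <-irrefl refl m<N
  notN (there m∈ys) = m∉ (∈-++⁺ʳ xs m∈ys)

module _ {n : ℕ} where

  O-L⁺ : ∀ {a b : Fin n} → toℕ a < toℕ b → O (L n) a b ≡ true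
  O-L⁺ = to T-≡ ∘ <⇒<ᵇ

  O-L⁻ : ∀ {a b : Fin n} → O (L n) a b ≡ true → toℕ a < toℕ b
  O-L⁻ {a} {b} = <ᵇ⇒< (toℕ a) (toℕ b) ∘ from T-≡

  S-L⁺ : ∀ {a b : Fin n} → suc (toℕ a) ≡ toℕ b → S (L n) a b ≡ true
  S-L⁺ {a} {b} = to T-≡ ∘ ≡⇒≡ᵇ (suc (toℕ a)) (toℕ b)

  P-L⁻ : ∀ {a : Fin n} → P (L n) a ≡ true → toℕ a ≡ 0 ⊎ suc (toℕ a) ≡ n
  P-L⁻ {a} = Sum.map (≡ᵇ⇒≡ (toℕ a) 0) (≡ᵇ⇒≡ (suc (toℕ a)) n) ∘ to T-∨ ∘ from T-≡

  ≤-L⁺ : ∀ {a b : Fin n} → toℕ a ≤ toℕ b → _≤ᴬ_ (L n) a b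
  ≤-L⁺ a≤b with m≤n⇒m<n∨m≡n a≤b
  ... | inj₁ a<b = inj₁ (O-L⁺ a<b)
  ... | inj₂ a≡b = inj₂ (toℕ-injective a≡b)

  ≤-L-total : ∀ (a b : Fin n) → _≤ᴬ_ (L n) a b ⊎ _≤ᴬ_ (L n) b a
  ≤-L-total a b = Sum.map ≤-L⁺ ≤-L⁺ (≤-total (toℕ a) (toℕ b))

  P-L-endpoints : ∀ {x y : Fin n} → P (L n) x ≡ true → P (L n) y ≡ true →
                  O (L n) x y ≡ true → toℕ x ≡ 0 × suc (toℕ y) ≡ n
  P-L-endpoints {x} {y} Px Py Oxy with P-L⁻ Px | P-L⁻ Py
  ... | inj₁ x≡0   | inj₂ 1+y≡n = x≡0 , 1+y≡n
  ... | inj₂ 1+x≡n | _          =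
    contradiction (<-≤-trans (O-L⁻ Oxy) (≤-pred (subst (toℕ y <_) (sym 1+x≡n) (toℕ<n y))))
                  (<-irrefl refl)
  ... | _          | inj₁ y≡0   = contradiction (subst (toℕ x <_) y≡0 (O-L⁻ Oxy)) λ ()

  β-L-endpoints : ∀ {x y : Fin n} z → toℕ x ≡ 0 → suc (toℕ y) ≡ n → β (L n) x y z
  β-L-endpoints z x≡0 1+y≡n =
    ≤-L⁺ (subst (_≤ toℕ z) (sym x≡0) z≤n) ,
    ≤-L⁺ (≤-pred (subst (toℕ z <_) (sym 1+y≡n) (toℕ<n z)))

  ν-L⁺ : ∀ {a b : Fin n} → suc (toℕ a) ≡ toℕ b → ν (L n) a b
  ν-L⁺ {a} {b} 1+a≡b = O-L⁺ (≤-reflexive 1+a≡b) , λ w (Oaw , Owb) →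
    <-irrefl refl (≤-trans (s≤s (O-L⁻ Oaw)) (subst (suc (toℕ w) ≤_) (sym 1+a≡b) (O-L⁻ Owb)))

  -- if b were not the successor of a, the successor of a would lie strictly between them
  ν-L⁻ : ∀ {a b : Fin n} → ν (L n) a b → suc (toℕ a) ≡ toℕ b
  ν-L⁻ {a} {b} (Oab , nothing-between) with suc (toℕ a) ≟ toℕ b
  ... | yes 1+a≡b = 1+a≡b
  ... | no 1+a≢b  = contradiction (O-L⁺ a<w , O-L⁺ w<b) (nothing-between w)
    where
    1+a<b : suc (toℕ a) < toℕ b
    1+a<b = ≤∧≢⇒< (O-L⁻ Oab) 1+a≢b
    w : Fin n
    w = fromℕ< (<-trans 1+a<b (toℕ<n b))
    w≡1+a : toℕ w ≡ suc (toℕ a)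
    w≡1+a = toℕ-fromℕ< (<-trans 1+a<b (toℕ<n b))
    a<w : toℕ a < toℕ w
    a<w = ≤-reflexive (sym w≡1+a)
    w<b : toℕ w < toℕ b
    w<b = subst (_< toℕ b) (sym w≡1+a) 1+a<b

φ-holds-L : ∀ k → φ-holds (L (2 + k))
φ-holds-L k =
  zero , fromℕ (suc k) , refl , P-last ,
  (refl , λ z₁ z₂ _ → ≤-L-total z₁ z₂) ,
  λ z₁ z₂ (_ , _ , ν₁₂) → S-L⁺ {a = z₁} {z₂} (ν-L⁻ ν₁₂)
  where
  P-last : P (L (2 + k)) (fromℕ (suc k)) ≡ true
  P-last = to T-≡ (≡⇒≡ᵇ _ k (toℕ-fromℕ k))

¬φ-holds-dropSFrom-L : ∀ k m → m < suc k → ¬ φ-holds (dropSFrom (L (2 + k)) m)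
¬φ-holds-dropSFrom-L k m m<1+k (x , y , Px , Py , (Oxy , _) , S-between)
  with x≡0 , 1+y≡n ← P-L-endpoints Px Py Oxy =
  dropSFrom-¬S (L (2 + k)) m {z₁} {z₂} z₁≡m
    (S-between z₁ z₂ (β-L-endpoints z₁ x≡0 1+y≡n , β-L-endpoints z₂ x≡0 1+y≡n ,
                      ν-L⁺ {a = z₁} {z₂} (trans (cong suc z₁≡m) (sym z₂≡1+m))))
  where
  z₁ z₂ : Fin (2 + k)
  z₁ = fromℕ< (m≤n⇒m≤1+n m<1+k)
  z₂ = fromℕ< (s≤s m<1+k)
  z₁≡m : toℕ z₁ ≡ m
  z₁≡m = toℕ-fromℕ< (m≤n⇒m≤1+n m<1+k)
  z₂≡1+m : toℕ z₂ ≡ suc m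
  z₂≡1+m = toℕ-fromℕ< (s≤s m<1+k)

⊨-dropSFrom-L : (ψ : EPSentence) → L (2 + countS ψ) ⊨ ψ →
  ∃ λ m → m < suc (countS ψ) × dropSFrom (L (2 + countS ψ)) m ⊨ ψ
⊨-dropSFrom-L ψ L⊨ψ
  with l , l≤k , survives ← Sat-dropSFrom (L (2 + countS ψ)) ψ emptyEnv L⊨ψ
  with m , m<1+k , m∉l ← ∃∉-below (suc (countS ψ)) l (s≤s l≤k) =
  m , m<1+k , survives m m∉l

mainTheorem12 : ¬ (Σ EPSentence λ ψ → ∀ A → In𝒮 A → ((A ⊨ ψ) ⇔ φ-holds A))
mainTheorem12 (ψ , ψ⇔φ) = refute (⊨-dropSFrom-L ψ (from (ψ⇔φ (L n) (base n)) (φ-holds-L k)))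
  where
  k : ℕ
  k = countS ψ
  n : ℕ
  n = 2 + k
  refute : ¬ ∃ λ m → m < suc k × dropSFrom (L n) m ⊨ ψ
  refute (m , m<1+k , dropped⊨ψ) =
    ¬φ-holds-dropSFrom-L k m m<1+k
      (to (ψ⇔φ _ (sub (base n) (dropSFrom-SubOf (L n) m))) dropped⊨ψ)
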